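{- Let $n\ge 4$ be an integer, let $\gamma=0$ if $n$ is even and $\gamma=1$ if $n$ is odd, and let $H_n^4$ be any graph in $\mathscr{H}_n^4$. For $t\in\{0,1,\dots,\lfloor n/2\rfloor-1\}$ put $g_t=\lceil 2^{2t+2+\gamma}/3\rceil$. Then for every such $t$ and every integer $h$ with $2^{\lceil n/2\rceil+t}-g_t\le h\le 2^{\lceil n/2\rceil+t}$, $$\lambda_h(H_n^4)=\xi_{2^{\lceil n/2\rceil+t}}(H_n^4)=(\lfloor n/2\rfloor-t)\,2^{\lceil n/2\rceil+t}.$$
   Context: The family $\mathscr{H}_n^4$ ($n\ge 2$) of $n$-dimensional $K_4$-hypercubes is defined recursively: $\mathscr{H}_2^4=\{K_4\}$; for $n\ge 3$, a graph belongs to $\mathscr{H}_n^4$ if and only if (up to isomorphism) it is obtained from two vertex-disjoint graphs $G_0,G_1\in\mathscr{H}_{n-1}^4$ (not necessarily isomorphic) by adding an arbitrary perfect matching between $V(G_0)$ and $V(G_1)$. Each member of $\mathscr{H}_n^4$ is $(n+1)$-regular with $2^n$ vertices. For a graph $G$ and $X\subseteq V(G)$, $\overline{X}=V(G)\setminus X$ and $[X,\overline{X}]$ is the set of edges with exactly one end in $X$. For $1\le m\le\lfloor |V(G)|/2\rfloor$, $\xi_m(G)=\min\{|[X,\overline{X}]| : |X|=m,\ G[X]\text{ and }G[\overline{X}]\text{ both connected}\}$. For a connected graph $G$ and integer $h\ge1$, the $h$-extra edge-connectivity $\lambda_h(G)$ is the minimum size of an edge set $F\subseteq E(G)$ such that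 $G-F$ is disconnected and every component of $G-F$ has at least $h$ vertices. -}

module Defs where

open import Data.Nat using (ℕ; zero; suc; _+_; _*_; _∸_; _^_; _≤_; _<_; _<ᵇ_; ⌊_/2⌋; ⌈_/2⌉)
open import Data.Nat.DivMod using (_/_; _%_)
open import Data.Bool using (Bool; true; false; _∧_; not; if_then_else_)
open import Data.Fin using (Fin; zero; suc; toℕ; _↑ˡ_; _↑ʳ_; splitAt)
open import Data.Fin.Properties using (_≟_)
open import Data.Sum using (_⊎_; inj₁; inj₂)
open import Data.Product using (Σ; ∃; _×_; _,_)
open import Relation.Nullary using (¬_; does)
open import Relation.Binary.PropositionalEquality using (_≡_)
open import Function.Bundles using (_⤖_; Bijection)
open import Function.Definitions using (Injective)

Graph : ℕ → Set
Graph N = Fin N → Fin N → Bool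

# : ∀ {N} → (Fin N → Bool) → ℕ
# {zero}  P = 0
# {suc N} P = (if P zero then 1 else 0) + # (λ i → P (suc i))

sumFin : ∀ {N} → (Fin N → ℕ) → ℕ
sumFin {zero}  f = 0
sumFin {suc N} f = f zero + sumFin (λ i → f (suc i))

#₂ : ∀ {N} → (Fin N → Fin N → Bool) → ℕ
#₂ P = sumFin (λ i → # (P i))

Iso : ∀ {N M} → Graph N → Graph M → Set
Iso {N} {M} G H = Σ (Fin N ⤖ Fin M) λ f →
  ∀ i j → G i j ≡ H (Bijection.to f i) (Bijection.to f j)

K4 : Graph 4
K4 i j = not (does (i ≟ j))

join : ∀ {N0 N1} → Graph N0 → Graph N1 → (Fin N0 ⤖ Fin N1) → Graph (N0 + N1)
join {N0} {N1} G0 G1 M i j with splitAt N0 i | splitAt N0 j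
... | inj₁ a | inj₁ b = G0 a b
... | inj₂ a | inj₂ b = G1 a b
... | inj₁ a | inj₂ b = does (b ≟ Bijection.to M a)
... | inj₂ a | inj₁ b = does (a ≟ Bijection.to M b)

data H4 : ℕ → (N : ℕ) → Graph N → Set where
  base : ∀ {G : Graph 4} → Iso K4 G → H4 2 4 G
  step : ∀ {n N0 N1} {G0 : Graph N0} {G1 : Graph N1} {G : Graph (N0 + N1)} →
         H4 n N0 G0 → H4 n N1 G1 → (M : Fin N0 ⤖ Fin N1) →
         Iso (join G0 G1 M) G → H4 (suc n) (N0 + N1) G

data Reach {N} (G : Graph N) (S : Fin N → Bool) : Fin N → Fin N → Set where
  here  : ∀ {u} → S u ≡ true → Reach G S u u
  there : ∀ {u w v} → S u ≡ true → G u w ≡ true → Reach G S w v → Reach G S u v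

Connected : ∀ {N} → Graph N → (Fin N → Bool) → Set
Connected G S = ∀ u v → S u ≡ true → S v ≡ true → Reach G S u v

allV : ∀ {N} → Fin N → Bool
allV _ = true

compl : ∀ {N} → (Fin N → Bool) → (Fin N → Bool)
compl X i = not (X i)

cut : ∀ {N} → Graph N → (Fin N → Bool) → ℕ
cut G X = #₂ λ x y → X x ∧ (not (X y) ∧ G x y)

IsXi : ∀ {N} → ℕ → Graph N → ℕ → Set
IsXi m G k =
  (Σ (_ → Bool) λ X → # X ≡ m × Connected G X × Connected G (compl X) × cut G X ≡ k)
  × (∀ X → # X ≡ m → Connected G X → Connected G (compl X) → k ≤ cut G X)

IsEdgeSet : ∀ {N} → Graph N → (Fin N → Fin N → Bool) → Set
IsEdgeSet G F = (∀ i j → F i j ≡ F j i) × (∀ i j → F i j ≡ true → G i j ≡ true)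

edgeCount : ∀ {N} → (Fin N → Fin N → Bool) → ℕ
edgeCount F = #₂ λ i j → (toℕ i <ᵇ toℕ j) ∧ F i j

delete : ∀ {N} → Graph N → (Fin N → Fin N → Bool) → Graph N
delete G F i j = G i j ∧ not (F i j)

IsExtraCut : ∀ {N} → ℕ → Graph N → (Fin N → Fin N → Bool) → Set
IsExtraCut {N} h G F =
  (Σ (Fin N) λ u → Σ (Fin N) λ v → ¬ Reach (delete G F) allV u v)
  × (∀ v → Σ (Fin h → Fin N) λ f →
       Injective _≡_ _≡_ f × (∀ i → Reach (delete G F) allV v (f i)))

IsLambda : ∀ {N} → ℕ → Graph N → ℕ → Set
IsLambda h G k =
  (Σ (_ → _ → Bool) λ F → IsEdgeSet G F × IsExtraCut h G F × edgeCount F ≡ k)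
  × (∀ F → IsEdgeSet G F → IsExtraCut h G F → k ≤ edgeCount F)

-- γ = n mod 2 ; g_t = ⌈ 2^(2t+2+γ) / 3 ⌉
γ : ℕ → ℕ
γ n = n % 2

g : ℕ → ℕ → ℕ
g n t = (2 ^ (2 * t + 2 + γ n) + 2) / 3

{-# OPTIONS --safe #-}

-- Among m-subsets X of a K₄-hypercube of dimension n, the edge boundary has at least
-- τ n m + δ m elements, where τ n m is the corresponding bound for the n-dimensional hypercube
-- and δ m = 0, 1, 2, 1 for m ≡ 0, 1, 2, 3 (mod 4) accounts for the two additional edges in each K₄.
-- This follows by induction on n from τ (n+1) (a+b) ≤ τ n a + τ n b + |a − b| and the
-- subadditivity of δ, as a perfect matching between halves containing a and b vertices of X
-- contributes at least |a − b| crossing edges.  A component of G − F or its complement is such an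
-- X, so everything reduces to showing τ n m + δ m ≥ (n − k) 2^k when m and 2^n − m are both at
-- least 2^k − g: for 2^k ≤ m ≤ 2^n − 2^k already τ suffices, and m = 2^k − s reduces by
-- reflection to an inequality for s ≤ g that is proved along g_t = 2^(2t+γ) + g_(t−1).
-- A subcube of dimension k attains the bound.
module Submission where

open import Defs
open import Data.Bool using (Bool; true; false; _∧_; not; if_then_else_; _xor_; T)
open import Data.Bool.Properties using (∧-assoc; ∧-zeroʳ; ∧-identityʳ; ∧-comm; xor-comm)
open import Data.Fin using (Fin; zero; suc; toℕ; _↑ˡ_; _↑ʳ_; splitAt; inject≤)
open import Data.Fin.Properties using (_≟_; splitAt-↑ˡ; splitAt-↑ʳ; splitAt⁻¹-↑ˡ; splitAt⁻¹-↑ʳ;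
  toℕ-injective; injective⇒≤; inject≤-injective; sequence)
  renaming (suc-injective to sucᶠ-injective)
open import Data.Nat hiding (_≟_)
open import Data.Nat.Divisibility using (divides-refl)
open import Data.Nat.DivMod using (/-congˡ; +-distrib-/-∣ˡ; m*n/n≡m)
open import Data.Nat.Properties hiding (_≟_)
open import Algebra.Properties.CommutativeMonoid.Sum +-0-commutativeMonoid
  using (sum; sum-cong-≗; ∑-distrib-+; ∑-comm; sum-permute)
open import Data.Nat.Tactic.RingSolver using (solve-∀)
open import Data.Product using (Σ; ∃; _×_; _,_; proj₁; proj₂)
open import Data.Sum using (inj₁; inj₂; [_,_]′)
open import Data.Unit using (tt)
open import Effect.Monad using (RawMonad)
open import Function using (_∘_)
open import Function.Bundles using (_⤖_; Bijection; Inverse)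
open import Function.Definitions using (Injective)
open import Function.Properties.Bijection using (⤖⇒↔; sym-≡)
open import Relation.Binary.PropositionalEquality hiding (J)
open import Relation.Nullary using (contradiction; ¬_; Dec; does; yes; no)
open import Relation.Nullary.Decidable using (¬¬-excluded-middle; decidable-stable; dec-true; dec-false)
open import Relation.Nullary.Negation using (¬¬-Monad; ¬¬-map)

open Bijection using (to)

-- The hypercube bound and its correction term.

-- For m ≤ 2^n this is the least edge boundary of m vertices in the n-dimensional hypercube, reached
-- by balanced halving. It equals 2^n T(m / 2^n) for the Takagi function T.
τ : ℕ → ℕ → ℕ
τ zero    m = 0
τ (suc n) m = τ n ⌊ m /2⌋ + τ n ⌈ m /2⌉ + (⌈ m /2⌉ ∸ ⌊ m /2⌋)

-- In `K4` the boundary of r vertices has r(4 - r) = 0, 3, 4, 3, 0 edges, while `τ 2 r` = 0, 2, 2,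
-- 2, 0. The difference, continued with period 4, is the distance from m to the nearest multiple of
-- 4.
δ : ℕ → ℕ
δ 0 = 0
δ 1 = 1
δ 2 = 2
δ 3 = 1
δ (suc (suc (suc (suc m)))) = δ m

-- A parity view with `c + c`, the shape to which `n≡⌊n+n/2⌋` and `n≡⌈n+n/2⌉` apply.
data Half : ℕ → Set where
  even : ∀ c → Half (c + c)
  odd  : ∀ c → Half (suc (c + c))

half : ∀ m → Half m
half zero = even 0
half (suc m) with half m
... | even c = odd c
... | odd c  = subst Half (cong suc (+-suc c c)) (even (suc c))

τ-even : ∀ n c → τ (suc n) (c + c) ≡ τ n c + τ n c
τ-even n c rewrite sym (n≡⌊n+n/2⌋ c) | sym (n≡⌈n+n/2⌉ c) | n∸n≡0 c = +-identityʳ _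

τ-odd : ∀ n c → τ (suc n) (suc (c + c)) ≡ suc (τ n c + τ n (suc c))
τ-odd n c rewrite sym (n≡⌊n+n/2⌋ c) | sym (n≡⌈n+n/2⌉ c) | m+n∸n≡m 1 c = +-comm _ 1

halve-≤ : ∀ {c d} → c + c ≤ d + d → c ≤ d
halve-≤ {c} {d} p = subst₂ _≤_ (sym (n≡⌊n+n/2⌋ c)) (sym (n≡⌊n+n/2⌋ d)) (⌊n/2⌋-mono p)

halve-< : ∀ {c d} → suc (c + c) ≤ d + d → c < d
halve-< {c} {d} p =
  subst₂ _≤_ (cong suc (sym (n≡⌊n+n/2⌋ c))) (sym (n≡⌈n+n/2⌉ d)) (⌈n/2⌉-mono p)

halve-≤-suc : ∀ {c d} → c + c ≤ suc (d + d) → c ≤ d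
halve-≤-suc {c} {d} p =
  subst₂ _≤_ (sym (n≡⌊n+n/2⌋ c)) (sym (n≡⌈n+n/2⌉ d)) (⌊n/2⌋-mono p)

halve-≡ : ∀ {c d} → c + c ≡ d + d → c ≡ d
halve-≡ {c} {d} p = ≤-antisym (halve-≤ {c} {d} (≤-reflexive p)) (halve-≤ {d} {c} (≤-reflexive (sym p)))

odd≢even : ∀ c d → suc (c + c) ≢ d + d
odd≢even c d p =
  <⇒≱ (halve-< {c} {d} (≤-reflexive p)) (halve-≤-suc {d} {c} (≤-reflexive (sym p)))

2^-suc : ∀ n → 2 ^ suc n ≡ 2 ^ n + 2 ^ n
2^-suc n = cong (2 ^ n +_) (+-identityʳ (2 ^ n))

interchange : ∀ a b c d → (a + b) + (c + d) ≡ (a + c) + (b + d)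
interchange = solve-∀

odd+odd : ∀ c d → suc (c + c) + suc (d + d) ≡ (c + suc d) + (c + suc d)
odd+odd = solve-∀

τ-one : ∀ n → n ≤ τ n 1
τ-one zero    = z≤n
τ-one (suc n) = subst (suc n ≤_) (sym (τ-odd n 0)) (s≤s (≤-trans (τ-one n) (m≤n+m (τ n 1) (τ n 0))))

-- For even m the two halves give n + n, which is at least n + 1 because 0 < c < 2^n forces n ≥ 1.
-- For odd m the smaller half gives n and the imbalance gives the missing unit; the larger half may
-- fill its cube and is discarded.
τ-lower₀ : ∀ n {m} → 1 ≤ m → m < 2 ^ n → n ≤ τ n m
τ-lower₀ zero    _  _ = z≤n
τ-lower₀ (suc n) {m} 1≤m m<2^ rewrite +-identityʳ (2 ^ n) with half m
... | even c@(suc _) = begin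
  1 + n             ≤⟨ +-monoˡ-≤ n (1≤n n (halve-< m<2^)) ⟩
  n + n             ≤⟨ +-mono-≤ ih ih ⟩
  τ n c + τ n c     ≡⟨ τ-even n c ⟨
  τ (suc n) (c + c) ∎
  where
  open ≤-Reasoning
  ih = τ-lower₀ n (s≤s z≤n) (halve-< m<2^)
  1≤n : ∀ n → c < 2 ^ n → 1 ≤ n
  1≤n zero    (s≤s ())
  1≤n (suc n) _ = s≤s z≤n
... | odd zero = τ-one (suc n)
... | odd c@(suc _) = begin
  suc n                      ≤⟨ s≤s (τ-lower₀ n (s≤s z≤n) (halve-< (<⇒≤ m<2^))) ⟩
  suc (τ n c)                ≤⟨ s≤s (m≤m+n (τ n c) (τ n (suc c))) ⟩
  suc (τ n c + τ n (suc c))  ≡⟨ τ-odd n c ⟨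
  τ (suc n) (suc (c + c)) ∎
  where open ≤-Reasoning

-- Halving m lowers k by one and keeps j. For k > 0 the ends 2^k and 2^(j+k) - 2^k of the range are
-- even and halve to the ends of the next range, so for odd m both c and c + 1 stay inside.
τ-lower : ∀ j k {m} → 2 ^ k ≤ m → m + 2 ^ k ≤ 2 ^ (j + k) → j * 2 ^ k ≤ τ (j + k) m
τ-lower j zero {m} p q rewrite +-identityʳ j | *-identityʳ j =
  τ-lower₀ j p (subst (_≤ 2 ^ j) (+-comm m 1) q)
τ-lower j (suc k) {m} p q
  rewrite +-suc j k | +-identityʳ (2 ^ k) | +-identityʳ (2 ^ (j + k)) | *-distribˡ-+ j (2 ^ k) (2 ^ k)
  with half m
... | even c = subst (j * 2 ^ k + j * 2 ^ k ≤_) (sym (τ-even (j + k) c)) (+-mono-≤ ih ih)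
  where
  ih = τ-lower j k (halve-≤ p) (halve-≤ (subst (_≤ 2 ^ (j + k) + 2 ^ (j + k)) (interchange c c (2 ^ k) (2 ^ k)) q))
... | odd c = subst (j * 2 ^ k + j * 2 ^ k ≤_) (sym (τ-odd (j + k) c))
  (≤-trans (+-mono-≤ (τ-lower j k p′ (≤-trans (n≤1+n _) q′)) (τ-lower j k (m≤n⇒m≤1+n p′) q′))
           (n≤1+n _))
  where
  p′ = halve-≤-suc p
  q′ = halve-< (subst (_≤ 2 ^ (j + k) + 2 ^ (j + k)) (cong suc (interchange c c (2 ^ k) (2 ^ k))) q)

-- A set that fits into one half of the larger cube gains one boundary edge per vertex, in the new
-- direction.
τ-double : ∀ n {s} → s ≤ 2 ^ n → τ (suc n) s ≡ τ n s + s
τ-double zero    z≤n       = refl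
τ-double zero    (s≤s z≤n) = refl
τ-double (suc n) {s} p rewrite +-identityʳ (2 ^ n) with half s
... | even c = begin
  τ (suc (suc n)) (c + c)              ≡⟨ τ-even (suc n) c ⟩
  τ (suc n) c + τ (suc n) c            ≡⟨ cong₂ _+_ (τ-double n (halve-≤ p)) (τ-double n (halve-≤ p)) ⟩
  (τ n c + c) + (τ n c + c)            ≡⟨ interchange (τ n c) c (τ n c) c ⟩
  (τ n c + τ n c) + (c + c)            ≡⟨ cong (_+ (c + c)) (τ-even n c) ⟨
  τ (suc n) (c + c) + (c + c) ∎
  where open ≡-Reasoning
... | odd c = begin
  τ (suc (suc n)) (suc (c + c))
    ≡⟨ τ-odd (suc n) c ⟩
  suc (τ (suc n) c + τ (suc n) (suc c))
    ≡⟨ cong suc (cong₂ _+_ (τ-double n (<⇒≤ (halve-< p))) (τ-double n (halve-< p))) ⟩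
  suc ((τ n c + c) + (τ n (suc c) + suc c))
    ≡⟨ lemma (τ n c) (τ n (suc c)) c ⟩
  suc (τ n c + τ n (suc c)) + suc (c + c)
    ≡⟨ cong (_+ suc (c + c)) (τ-odd n c) ⟨
  τ (suc n) (suc (c + c)) + suc (c + c) ∎
  where
  open ≡-Reasoning
  lemma : ∀ x y c → suc ((x + c) + (y + suc c)) ≡ suc (x + y) + suc (c + c)
  lemma = solve-∀

-- Complementary sets have the same boundary. Halving pairs c with d, or for two odd sizes c with d
-- + 1 and c + 1 with d; mixed parities contradict the even total.
τ-sym : ∀ n {a b} → a + b ≡ 2 ^ n → τ n a ≡ τ n b
τ-sym zero    _ = refl
τ-sym (suc n) {a} {b} p rewrite +-identityʳ (2 ^ n) with half a | half b
... | even c | even d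
  rewrite τ-even n c | τ-even n d
        | τ-sym n {c} {d} (halve-≡ (trans (interchange c d c d) p)) = refl
... | odd c | odd d
  rewrite τ-odd n c | τ-odd n d
        | τ-sym n {c} {suc d} (halve-≡ (trans (sym (odd+odd c d)) p))
        | τ-sym n {suc c} {d} (halve-≡ (trans (cong₂ _+_ (sym (+-suc c d)) (sym (+-suc c d)))
            (trans (sym (odd+odd c d)) p))) = cong suc (+-comm (τ n (suc d)) (τ n d))
... | odd c | even d = contradiction (trans (cong suc (interchange c d c d)) p) (odd≢even (c + d) (2 ^ n))
... | even c | odd d =
  contradiction (trans (cong suc (interchange c d c d)) (trans (sym (+-suc (c + c) (d + d))) p)) (odd≢even (c + d) (2 ^ n))

∣-∣-double : ∀ c d → ∣ c + c - d + d ∣ ≡ ∣ c - d ∣ + ∣ c - d ∣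
∣-∣-double zero    d       = refl
∣-∣-double (suc c) zero    = refl
∣-∣-double (suc c) (suc d) rewrite +-suc c c | +-suc d d = ∣-∣-double c d

-- The consecutive integers c - d and c + 1 - d never have opposite signs, so their absolute values
-- add without cancellation.
∣-∣-odd : ∀ c d → ∣ suc (c + c) - d + d ∣ ≡ ∣ c - d ∣ + ∣ suc c - d ∣
∣-∣-odd zero    zero    = refl
∣-∣-odd zero    (suc d) rewrite +-suc d d = refl
∣-∣-odd (suc c) zero    rewrite +-suc c c = cong suc (lemma c)
  where
  lemma : ∀ c → suc (suc (c + c)) ≡ c + suc (suc c)
  lemma = solve-∀
∣-∣-odd (suc c) (suc d) rewrite +-suc c c | +-suc d d = ∣-∣-odd c d

∣-∣-sucˡ : ∀ c d → ∣ suc c - d ∣ ≤ suc ∣ c - d ∣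
∣-∣-sucˡ c zero    = s≤s (≤-reflexive (sym (∣-∣-identityʳ c)))
∣-∣-sucˡ zero (suc d) = ≤-trans (n≤1+n d) (n≤1+n (suc d))
∣-∣-sucˡ (suc c) (suc d) = ∣-∣-sucˡ c d

∣-∣-sucʳ : ∀ c d → ∣ c - suc d ∣ ≤ suc ∣ c - d ∣
∣-∣-sucʳ c d = subst₂ _≤_ (∣-∣-comm (suc d) c) (cong suc (∣-∣-comm d c)) (∣-∣-sucˡ d c)

-- `τ 1` is the parity of its argument, and the difference of a and b has the parity of a + b.
τ₁-subadd : ∀ a b → τ 1 (a + b) ≤ ∣ a - b ∣
τ₁-subadd zero    b = ≤-trans (m∸n≤m ⌈ b /2⌉ ⌊ b /2⌋) (⌈n/2⌉≤n b)
τ₁-subadd (suc a) zero rewrite +-identityʳ a =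
  ≤-trans (m∸n≤m ⌈ suc a /2⌉ ⌊ suc a /2⌋) (⌈n/2⌉≤n (suc a))
τ₁-subadd (suc a) (suc b) rewrite +-suc a b = τ₁-subadd a b

-- Induction by halving a and b together: their halves recombine into the balanced halves of a + b,
-- and the resulting absolute differences are paid for by the difference of a and b and the units of
-- `τ-odd`.
τ-subadd : ∀ n a b → τ (suc n) (a + b) ≤ τ n a + τ n b + ∣ a - b ∣

τ-subadd-odd : ∀ n c d →
  τ (suc (suc n)) (suc (c + c) + (d + d)) ≤
  τ (suc n) (suc (c + c)) + τ (suc n) (d + d) + ∣ suc (c + c) - d + d ∣
τ-subadd-odd n c d = begin
  τ (suc (suc n)) (suc (c + c) + (d + d))
    ≡⟨ cong (λ z → τ (suc (suc n)) (suc z)) (interchange c c d d) ⟩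
  τ (suc (suc n)) (suc ((c + d) + (c + d)))
    ≡⟨ τ-odd (suc n) (c + d) ⟩
  suc (τ (suc n) (c + d) + τ (suc n) (suc c + d))
    ≤⟨ s≤s (+-mono-≤ (τ-subadd n c d) (τ-subadd n (suc c) d)) ⟩
  suc ((τ n c + τ n d + ∣ c - d ∣) + (τ n (suc c) + τ n d + ∣ suc c - d ∣))
    ≡⟨ lemma (τ n c) (τ n d) ∣ c - d ∣ (τ n (suc c)) ∣ suc c - d ∣ ⟩
  suc (τ n c + τ n (suc c)) + (τ n d + τ n d) + (∣ c - d ∣ + ∣ suc c - d ∣)
    ≡⟨ cong₂ _+_ (cong₂ _+_ (τ-odd n c) (τ-even n d)) (∣-∣-odd c d) ⟨
  τ (suc n) (suc (c + c)) + τ (suc n) (d + d) + ∣ suc (c + c) - d + d ∣ ∎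
  where
  open ≤-Reasoning
  lemma : ∀ x y z u w → suc ((x + y + z) + (u + y + w)) ≡ suc (x + u) + (y + y) + (z + w)
  lemma = solve-∀

τ-subadd zero a b = τ₁-subadd a b
τ-subadd (suc n) a b with half a | half b
... | even c | even d = begin
  τ (suc (suc n)) ((c + c) + (d + d))
    ≡⟨ cong (τ (suc (suc n))) (interchange c c d d) ⟩
  τ (suc (suc n)) ((c + d) + (c + d))
    ≡⟨ τ-even (suc n) (c + d) ⟩
  τ (suc n) (c + d) + τ (suc n) (c + d)
    ≤⟨ +-mono-≤ (τ-subadd n c d) (τ-subadd n c d) ⟩
  (τ n c + τ n d + ∣ c - d ∣) + (τ n c + τ n d + ∣ c - d ∣)
    ≡⟨ lemma (τ n c) (τ n d) ∣ c - d ∣ ⟩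
  (τ n c + τ n c) + (τ n d + τ n d) + (∣ c - d ∣ + ∣ c - d ∣)
    ≡⟨ cong₂ _+_ (cong₂ _+_ (τ-even n c) (τ-even n d)) (∣-∣-double c d) ⟨
  τ (suc n) (c + c) + τ (suc n) (d + d) + ∣ c + c - d + d ∣ ∎
  where
  open ≤-Reasoning
  lemma : ∀ x y z → (x + y + z) + (x + y + z) ≡ (x + x) + (y + y) + (z + z)
  lemma = solve-∀
... | odd c | even d = τ-subadd-odd n c d
... | even c | odd d =
  subst₂ _≤_ (cong (τ (suc (suc n))) (+-comm (suc (d + d)) (c + c)))
    (cong₂ _+_ (+-comm (τ (suc n) (suc (d + d))) (τ (suc n) (c + c))) (∣-∣-comm (suc (d + d)) (c + c)))
    (τ-subadd-odd n d c)
-- The pairing is crossed, c with d + 1 and c + 1 with d, so that both sums are c + d + 1. Each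
-- absolute difference grows by at most one, which the two units of `τ-odd` absorb.
... | odd c | odd d = begin
  τ (suc (suc n)) (suc (c + c) + suc (d + d))
    ≡⟨ cong (τ (suc (suc n))) (odd+odd c d) ⟩
  τ (suc (suc n)) ((c + suc d) + (c + suc d))
    ≡⟨ τ-even (suc n) (c + suc d) ⟩
  τ (suc n) (c + suc d) + τ (suc n) (c + suc d)
    ≡⟨ cong (λ z → τ (suc n) (c + suc d) + τ (suc n) z) (+-suc c d) ⟩
  τ (suc n) (c + suc d) + τ (suc n) (suc c + d)
    ≤⟨ +-mono-≤ (τ-subadd n c (suc d)) (τ-subadd n (suc c) d) ⟩
  (τ n c + τ n (suc d) + ∣ c - suc d ∣) + (τ n (suc c) + τ n d + ∣ suc c - d ∣)
    ≤⟨ +-mono-≤ (+-monoʳ-≤ (τ n c + τ n (suc d)) (∣-∣-sucʳ c d))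
                (+-monoʳ-≤ (τ n (suc c) + τ n d) (∣-∣-sucˡ c d)) ⟩
  (τ n c + τ n (suc d) + suc ∣ c - d ∣) + (τ n (suc c) + τ n d + suc ∣ c - d ∣)
    ≡⟨ lemma′ (τ n c) (τ n (suc c)) (τ n d) (τ n (suc d)) ∣ c - d ∣ ⟩
  suc (τ n c + τ n (suc c)) + suc (τ n d + τ n (suc d)) + (∣ c - d ∣ + ∣ c - d ∣)
    ≡⟨ cong₂ _+_ (cong₂ _+_ (τ-odd n c) (τ-odd n d)) (∣-∣-double c d) ⟨
  τ (suc n) (suc (c + c)) + τ (suc n) (suc (d + d)) + ∣ suc (c + c) - suc (d + d) ∣ ∎
  where
  open ≤-Reasoning
  lemma′ : ∀ x x′ y y′ z →
    (x + y′ + suc z) + (x′ + y + suc z) ≡ suc (x + x′) + suc (y + y′) + (z + z)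
  lemma′ = solve-∀

δ≤2 : ∀ m → δ m ≤ 2
δ≤2 0 = z≤n
δ≤2 1 = s≤s z≤n
δ≤2 2 = ≤-refl
δ≤2 3 = s≤s z≤n
δ≤2 (suc (suc (suc (suc m)))) = δ≤2 m

δ-1+ : ∀ m → δ (1 + m) ≤ 1 + δ m
δ-1+ 0 = ≤-refl
δ-1+ 1 = ≤-refl
δ-1+ 2 = s≤s z≤n
δ-1+ 3 = z≤n
δ-1+ (suc (suc (suc (suc m)))) = δ-1+ m

δ-3+ : ∀ m → δ (3 + m) ≤ 1 + δ m
δ-3+ 0 = ≤-refl
δ-3+ 1 = z≤n
δ-3+ 2 = s≤s z≤n
δ-3+ 3 = ≤-refl
δ-3+ (suc (suc (suc (suc m)))) = δ-3+ m

-- The triangle inequality for the distance to the multiples of 4, by the residue of a: residues 1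
-- and 3 move the distance by at most one, and residue 2 already contributes the maximum 2.
δ-subadd : ∀ a b → δ (a + b) ≤ δ a + δ b
δ-subadd 0 b = ≤-refl
δ-subadd 1 b = δ-1+ b
δ-subadd 2 b = ≤-trans (δ≤2 (2 + b)) (m≤m+n 2 (δ b))
δ-subadd 3 b = δ-3+ b
δ-subadd (suc (suc (suc (suc a)))) b = δ-subadd a b

δ-periodic : ∀ q r → δ (q * 4 + r) ≡ δ r
δ-periodic zero    r = refl
δ-periodic (suc q) r = δ-periodic q r

δ-sym : ∀ q a {b} → a + b ≡ q * 4 → δ a ≡ δ b
δ-sym q 0 refl = sym (trans (cong δ (sym (+-identityʳ (q * 4)))) (δ-periodic q 0))
δ-sym (suc q) 1 refl = sym (trans (cong δ (+-comm 3 (q * 4))) (δ-periodic q 3))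
δ-sym (suc q) 2 refl = sym (trans (cong δ (+-comm 2 (q * 4))) (δ-periodic q 2))
δ-sym (suc q) 3 refl = sym (trans (cong δ (+-comm 1 (q * 4))) (δ-periodic q 1))
δ-sym (suc q) (suc (suc (suc (suc a)))) eq =
  δ-sym q a (suc-injective (suc-injective (suc-injective (suc-injective eq))))

2^[2+k] : ∀ k → 2 ^ (2 + k) ≡ 2 ^ k * 4
2^[2+k] k = lemma (2 ^ k)
  where
  lemma : ∀ x → 2 * (2 * x) ≡ x * 4
  lemma = solve-∀

δ-sym-2^ : ∀ k a {b} → 2 ≤ k → a + b ≡ 2 ^ k → δ a ≡ δ b
δ-sym-2^ (suc zero) a (s≤s ())
δ-sym-2^ (suc (suc k)) a _ eq = δ-sym (2 ^ k) a (trans eq (2^[2+k] k))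

-- The threshold `gap` and the numerical lower bound.

-- ⌈ 2^(p+2) / 3 ⌉
gap : ℕ → ℕ
gap 0 = 2
gap 1 = 3
gap (suc (suc p)) = 2 ^ (2 + p) + gap p

-- Places every s ≤ `gap p` within a cube of dimension p + 1, the range in which `τ-double` and
-- `τ-shift` apply.
gap≤2^ : ∀ p → gap p ≤ 2 ^ suc p
gap≤2^ 0 = ≤-refl
gap≤2^ 1 = n≤1+n 3
gap≤2^ (suc (suc p)) = begin
  2 ^ (2 + p) + gap p          ≤⟨ +-monoʳ-≤ (2 ^ (2 + p)) (gap≤2^ p) ⟩
  2 ^ (2 + p) + 2 ^ suc p      ≤⟨ +-monoʳ-≤ (2 ^ (2 + p)) (^-monoʳ-≤ 2 (n≤1+n (suc p))) ⟩
  2 ^ (2 + p) + 2 ^ (2 + p)    ≡⟨ 2^-suc (2 + p) ⟨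
  2 ^ (3 + p) ∎
  where open ≤-Reasoning

-- Since 2^(p+4) = 3 * 2^(p+2) + 2^(p+2), passing from p to p + 2 raises the ceiling by exactly
-- 2^(p+2).
gap≡ceil : ∀ p → (2 ^ (p + 2) + 2) / 3 ≡ gap p
gap≡ceil 0 = refl
gap≡ceil 1 = refl
gap≡ceil (suc (suc p)) = begin
  (2 ^ (2 + p + 2) + 2) / 3                    ≡⟨ /-congˡ {o = 3} (lemma (2 ^ (p + 2))) ⟩
  (2 ^ (p + 2) * 3 + (2 ^ (p + 2) + 2)) / 3    ≡⟨ +-distrib-/-∣ˡ (2 ^ (p + 2) + 2) {3} (divides-refl (2 ^ (p + 2))) ⟩
  2 ^ (p + 2) * 3 / 3 + (2 ^ (p + 2) + 2) / 3  ≡⟨ cong₂ _+_ (m*n/n≡m (2 ^ (p + 2)) 3) (gap≡ceil p) ⟩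
  2 ^ (p + 2) + gap p                          ≡⟨ cong (λ z → 2 ^ z + gap p) (+-comm p 2) ⟩
  2 ^ (2 + p) + gap p ∎
  where
  open ≡-Reasoning
  lemma : ∀ x → 2 * (2 * x) + 2 ≡ x * 3 + (x + 2)
  lemma = solve-∀

τ-shift : ∀ j k {m} → m ≤ 2 ^ k → τ (j + k) m ≡ j * m + τ k m
τ-shift zero    k p = refl
τ-shift (suc j) k {m} p = begin
  τ (suc (j + k)) m      ≡⟨ τ-double (j + k) (≤-trans p (^-monoʳ-≤ 2 (m≤n+m k j))) ⟩
  τ (j + k) m + m        ≡⟨ cong (_+ m) (τ-shift j k p) ⟩
  j * m + τ k m + m      ≡⟨ lemma (j * m) (τ k m) m ⟩
  m + j * m + τ k m ∎
  where
  open ≡-Reasoning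
  lemma : ∀ x y z → x + y + z ≡ z + x + y
  lemma = solve-∀

-- Beyond 2^(p+2), reflecting s = 2^(p+2) + r about 2^(p+2) reduces p + 2 to p.
gap-lower : ∀ p {s} → s ≤ gap p → s ≤ τ (suc p) s + δ s
gap-lower 0 {0} _ = z≤n
gap-lower 0 {1} _ = s≤s z≤n
gap-lower 0 {2} _ = ≤-refl
gap-lower 0 {suc (suc (suc _))} (s≤s (s≤s ()))
gap-lower 1 {0} _ = z≤n
gap-lower 1 {1} _ = s≤s z≤n
gap-lower 1 {2} _ = s≤s (s≤s z≤n)
gap-lower 1 {3} _ = ≤-refl
gap-lower 1 {suc (suc (suc (suc _)))} (s≤s (s≤s (s≤s ())))
gap-lower (suc (suc p)) {s} s≤gap with ≤-total s (2 ^ (2 + p))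
... | inj₁ s≤ = begin
  s                              ≤⟨ m≤n+m s (τ (2 + p) s) ⟩
  τ (2 + p) s + s                ≡⟨ τ-double (2 + p) s≤ ⟨
  τ (3 + p) s                    ≤⟨ m≤m+n (τ (3 + p) s) (δ s) ⟩
  τ (3 + p) s + δ s ∎
  where open ≤-Reasoning
... | inj₂ ≤s with m≤n⇒∃[o]m+o≡n ≤s
... | r , refl = begin
  P + r                          ≡⟨ cong (_+ r) c+r≡P ⟨
  c + r + r                      ≤⟨ +-monoʳ-≤ (c + r) (gap-lower p r≤gap) ⟩
  c + r + (τ (1 + p) r + δ r)    ≡⟨ lemma c r (τ (1 + p) r) (δ r) ⟩
  τ (1 + p) r + r + c + δ r      ≡⟨ cong (λ z → z + c + δ r) (τ-double (1 + p) r≤2^) ⟨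
  τ (2 + p) r + c + δ r          ≡⟨ cong (λ z → z + c + δ r) (τ-sym (2 + p) {c} c+r≡P) ⟨
  τ (2 + p) c + c + δ r          ≡⟨ cong (_+ δ r) (τ-double (2 + p) (m+n≤o⇒m≤o c (≤-reflexive c+r≡P))) ⟨
  τ (3 + p) c + δ r              ≡⟨ cong₂ _+_ (τ-sym (3 + p) c+s≡) δ-r ⟩
  τ (3 + p) (P + r) + δ (P + r) ∎
  where
  open ≤-Reasoning
  P = 2 ^ (2 + p)
  r≤gap : r ≤ gap p
  r≤gap = +-cancelˡ-≤ P r (gap p) s≤gap
  r≤2^ : r ≤ 2 ^ (1 + p)
  r≤2^ = ≤-trans r≤gap (gap≤2^ p)
  -- c is complementary to r in dimension p + 2 and to s = P + r in dimension p + 3. `τ-sym` is used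
  -- once in each, and `τ-double` in between supplies the summand c.
  c = P ∸ r
  c+r≡P : c + r ≡ P
  c+r≡P = m∸n+n≡m (≤-trans r≤2^ (^-monoʳ-≤ 2 (n≤1+n (1 + p))))
  c+s≡ : c + (P + r) ≡ 2 ^ (3 + p)
  c+s≡ = trans (swap c P r) (trans (cong (P +_) c+r≡P) (sym (2^-suc (2 + p))))
    where
    swap : ∀ x y z → x + (y + z) ≡ y + (x + z)
    swap = solve-∀
  δ-r : δ r ≡ δ (P + r)
  δ-r = sym (trans (cong (λ z → δ (z + r)) (2^[2+k] p)) (δ-periodic (2 ^ p) r))
  lemma : ∀ c r x d → c + r + (x + d) ≡ x + r + c + d
  lemma = solve-∀

-- By `τ-shift`, m contributes (j + 1)m + `τ k m`, which leaves (j + 1)s to be found. Reflection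
-- turns `τ k m` into `τ k s` = js + `τ (suc p) s`, and the last s comes from `gap-lower`; so the
-- admissible s depend on p alone.
near-power-lower : ∀ j p {m s} → 2 ≤ suc j + p → m + s ≡ 2 ^ (suc j + p) → s ≤ gap p →
  suc j * 2 ^ (suc j + p) ≤ τ (suc j + (suc j + p)) m + δ m
near-power-lower j p {m} {s} 2≤k m+s≡ s≤ = begin
  suc j * 2 ^ k                            ≡⟨ cong (suc j *_) m+s≡ ⟨
  suc j * (m + s)                          ≡⟨ *-distribˡ-+ (suc j) m s ⟩
  suc j * m + suc j * s                    ≡⟨⟩
  suc j * m + (s + j * s)                  ≤⟨ +-monoʳ-≤ (suc j * m) (+-monoˡ-≤ (j * s) (gap-lower p s≤)) ⟩
  suc j * m + (τ (suc p) s + δ s + j * s)  ≡⟨ lemma (suc j * m) (τ (suc p) s) (δ s) (j * s) ⟩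
  suc j * m + (j * s + τ (suc p) s) + δ s  ≡⟨ cong (λ z → suc j * m + z + δ s) (τ-shift j (suc p) (≤-trans s≤ (gap≤2^ p))) ⟨
  suc j * m + τ (j + suc p) s + δ s        ≡⟨ cong (λ z → suc j * m + τ z s + δ s) (+-suc j p) ⟩
  suc j * m + τ k s + δ s                  ≡⟨ cong₂ (λ x y → suc j * m + x + y) (τ-sym k m+s≡) (δ-sym-2^ k m 2≤k m+s≡) ⟨
  suc j * m + τ k m + δ m                  ≡⟨ cong (_+ δ m) (τ-shift (suc j) k (m+n≤o⇒m≤o m (≤-reflexive m+s≡))) ⟨
  τ (suc j + k) m + δ m ∎
  where
  open ≤-Reasoning
  k = suc j + p
  lemma : ∀ x y z w → x + (y + z + w) ≡ x + (w + y) + z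
  lemma = solve-∀

cut-lower : ∀ j p {m m′} → 2 ≤ suc j + p → m + m′ ≡ 2 ^ (suc j + (suc j + p)) →
  2 ^ (suc j + p) ≤ m + gap p → 2 ^ (suc j + p) ≤ m′ + gap p →
  suc j * 2 ^ (suc j + p) ≤ τ (suc j + (suc j + p)) m + δ m
cut-lower j p {m} {m′} 2≤k eq m≥ m′≥
  with ≤-total (2 ^ (suc j + p)) m | ≤-total (2 ^ (suc j + p)) m′
... | inj₂ m≤ | _ with m≤n⇒∃[o]m+o≡n m≤
... | s , m+s≡ = near-power-lower j p 2≤k m+s≡
  (+-cancelˡ-≤ m s (gap p) (subst (_≤ m + gap p) (sym m+s≡) m≥))
-- Here the complement falls short of 2^k. Both `τ` and `δ` are invariant under exchanging m and m′,
-- so its bound carries over.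
cut-lower j p {m} {m′} 2≤k eq m≥ m′≥ | inj₁ _ | inj₂ m′≤ with m≤n⇒∃[o]m+o≡n m′≤
... | s , m′+s≡ =
  subst₂ (λ x y → suc j * 2 ^ (suc j + p) ≤ x + y)
    (sym (τ-sym (suc j + (suc j + p)) {m} {m′} eq))
    (sym (δ-sym-2^ (suc j + (suc j + p)) m (≤-trans 2≤k (m≤n+m (suc j + p) (suc j))) eq))
    (near-power-lower j p 2≤k m′+s≡
      (+-cancelˡ-≤ m′ s (gap p) (subst (_≤ m′ + gap p) (sym m′+s≡) m′≥)))
cut-lower j p {m} {m′} 2≤k eq m≥ m′≥ | inj₁ ≤m | inj₁ ≤m′ =
  ≤-trans (τ-lower (suc j) (suc j + p) ≤m (≤-trans (+-monoʳ-≤ m ≤m′) (≤-reflexive eq)))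
          (m≤m+n _ (δ m))

-- Counting over `Fin N`.

⟦_⟧ : Bool → ℕ
⟦ b ⟧ = if b then 1 else 0

-- Gives access to the library lemmas on exchanging and permuting summation.
sumFin≡sum : ∀ {N} (f : Fin N → ℕ) → sumFin f ≡ sum f
sumFin≡sum {zero}  f = refl
sumFin≡sum {suc N} f = cong (f zero +_) (sumFin≡sum (f ∘ suc))

#≡sum : ∀ {N} (P : Fin N → Bool) → # P ≡ sum (⟦_⟧ ∘ P)
#≡sum {zero}  P = refl
#≡sum {suc N} P = cong (⟦ P zero ⟧ +_) (#≡sum (P ∘ suc))


#₂≡sum : ∀ {N} (P : Fin N → Fin N → Bool) → #₂ P ≡ sum (λ i → sum (λ j → ⟦ P i j ⟧))
#₂≡sum P = trans (sumFin≡sum (λ i → # (P i))) (sum-cong-≗ (λ i → #≡sum (P i)))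

sum-mono : ∀ {N} {f h : Fin N → ℕ} → (∀ i → f i ≤ h i) → sum f ≤ sum h
sum-mono {zero}  p = z≤n
sum-mono {suc N} p = +-mono-≤ (p zero) (sum-mono (p ∘ suc))

sum-split : ∀ N₀ {N₁} (f : Fin (N₀ + N₁) → ℕ) →
  sum f ≡ sum (λ a → f (a ↑ˡ N₁)) + sum (λ b → f (N₀ ↑ʳ b))
sum-split zero     f = refl
sum-split (suc N₀) f =
  trans (cong (f zero +_) (sum-split N₀ (f ∘ suc))) (sym (+-assoc (f zero) _ _))

sum-⤖ : ∀ {N M} (φ : Fin N ⤖ Fin M) (f : Fin M → ℕ) → sum (f ∘ to φ) ≡ sum f
sum-⤖ φ f = sym (sum-permute f (⤖⇒↔ φ))

#-cong : ∀ {N} {P Q : Fin N → Bool} → (∀ i → P i ≡ Q i) → # P ≡ # Q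
#-cong {zero}  p = refl
#-cong {suc N} p = cong₂ (λ b m → ⟦ b ⟧ + m) (p zero) (#-cong (p ∘ suc))

#-false : ∀ N → # {N} (λ _ → false) ≡ 0
#-false zero    = refl
#-false (suc N) = #-false N

#-true : ∀ N → # {N} (λ _ → true) ≡ N
#-true zero    = refl
#-true (suc N) = cong suc (#-true N)

#-split : ∀ N₀ {N₁} (P : Fin (N₀ + N₁) → Bool) →
  # P ≡ # (λ a → P (a ↑ˡ N₁)) + # (λ b → P (N₀ ↑ʳ b))
#-split N₀ {N₁} P = trans (#≡sum P) (trans (sum-split N₀ (⟦_⟧ ∘ P))
  (sym (cong₂ _+_ (#≡sum (λ a → P (a ↑ˡ N₁))) (#≡sum (λ b → P (N₀ ↑ʳ b))))))

#-⤖ : ∀ {N M} (φ : Fin N ⤖ Fin M) (P : Fin M → Bool) → # (P ∘ to φ) ≡ # P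
#-⤖ φ P = trans (#≡sum (P ∘ to φ)) (trans (sum-⤖ φ (⟦_⟧ ∘ P)) (sym (#≡sum P)))

#-compl : ∀ {N} (P : Fin N → Bool) → # P + # (compl P) ≡ N
#-compl {zero}  P = refl
#-compl {suc N} P with P zero
... | true  = cong suc (#-compl (P ∘ suc))
... | false = trans (+-suc _ _) (cong suc (#-compl (P ∘ suc)))

#-singleton : ∀ {N} (P : Fin N → Bool) c → # (λ b → P b ∧ does (b ≟ c)) ≡ ⟦ P c ⟧
#-singleton {suc N} P zero = trans
  (cong₂ _+_ (cong ⟦_⟧ (∧-identityʳ (P zero)))
             (trans (#-cong (λ i → ∧-zeroʳ (P (suc i)))) (#-false N)))
  (+-identityʳ ⟦ P zero ⟧)
#-singleton P (suc c) = cong₂ _+_ (cong ⟦_⟧ (∧-zeroʳ (P zero))) (#-singleton (P ∘ suc) c)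

-- An index in exactly one of the two sets moves the difference of sizes by at most one. With Q
-- pulled back along a matching, the right side counts the matching edges that cross.
∣#-#∣≤ : ∀ {N} (P Q : Fin N → Bool) →
  ∣ # P - # Q ∣ ≤ # (λ i → P i ∧ not (Q i)) + # (λ i → Q i ∧ not (P i))
∣#-#∣≤ {zero}  P Q = z≤n
∣#-#∣≤ {suc N} P Q with P zero | Q zero | ∣#-#∣≤ (P ∘ suc) (Q ∘ suc)
... | true  | true  | ih = ih
... | true  | false | ih = ≤-trans (∣-∣-sucˡ (# (P ∘ suc)) (# (Q ∘ suc))) (s≤s ih)
... | false | true  | ih =
  ≤-trans (∣-∣-sucʳ (# (P ∘ suc)) (# (Q ∘ suc))) (≤-trans (s≤s ih) (≤-reflexive (sym (+-suc _ _))))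
... | false | false | ih = ih

enumerate : ∀ {N} (P : Fin N → Bool) →
  Σ (Fin (# P) → Fin N) λ f → Injective _≡_ _≡_ f × (∀ i → P (f i) ≡ true)
enumerate {zero}  P = (λ ()) , (λ { {()} }) , λ ()
enumerate {suc N} P with P zero in eq | enumerate (P ∘ suc)
... | false | f , f-inj , f∈P = suc ∘ f , f-inj ∘ sucᶠ-injective , f∈P
... | true  | f , f-inj , f∈P = f′ , f′-inj , f′∈P
  where
  f′ : Fin (suc (# (P ∘ suc))) → Fin (suc N)
  f′ zero    = zero
  f′ (suc i) = suc (f i)
  f′-inj : Injective _≡_ _≡_ f′
  f′-inj {zero}  {zero}  _ = refl
  f′-inj {suc i} {suc k} p = cong suc (f-inj (sucᶠ-injective p))
  f′∈P : ∀ i → P (f′ i) ≡ true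
  f′∈P zero    = eq
  f′∈P (suc i) = f∈P i

≤#⇒injection : ∀ {N h} (P : Fin N → Bool) → h ≤ # P →
  Σ (Fin h → Fin N) λ f → Injective _≡_ _≡_ f × (∀ i → P (f i) ≡ true)
≤#⇒injection P h≤ with enumerate P
... | f , f-inj , f∈P =
  (λ i → f (inject≤ i h≤)) , (λ eq → inject≤-injective h≤ h≤ _ _ (f-inj eq)) , λ i → f∈P (inject≤ i h≤)

data Side (N₀ N₁ : ℕ) : Fin (N₀ + N₁) → Set where
  left  : ∀ a → Side N₀ N₁ (a ↑ˡ N₁)
  right : ∀ b → Side N₀ N₁ (N₀ ↑ʳ b)

side : ∀ N₀ {N₁} x → Side N₀ N₁ x
side N₀ x with splitAt N₀ x in eq
... | inj₁ a = subst (Side N₀ _) (splitAt⁻¹-↑ˡ eq) (left a)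
... | inj₂ b = subst (Side N₀ _) (splitAt⁻¹-↑ʳ {N₀} eq) (right b)

-- Together with an enumeration of the complement of P, f injects Fin (h + # (compl P)) into Fin N.
injection⇒≤# : ∀ {N h} (P : Fin N → Bool) (f : Fin h → Fin N) →
  Injective _≡_ _≡_ f → (∀ i → P (f i) ≡ true) → h ≤ # P
injection⇒≤# {N} {h} P f f-inj f∈P with enumerate (compl P)
... | e , e-inj , e∉P = +-cancelʳ-≤ (# (compl P)) h (# P)
  (subst (h + # (compl P) ≤_) (sym (#-compl P)) (injective⇒≤ {f = f⊎e} f⊎e-injective))
  where
  f⊎e : Fin (h + # (compl P)) → Fin N
  f⊎e x = [ f , e ]′ (splitAt h x)
  disjoint : ∀ {a b} → f a ≢ e b
  disjoint {a} {b} eq with () ← trans (sym (cong not (f∈P a))) (trans (cong (not ∘ P) eq) (e∉P b))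
  f⊎e-injective : Injective _≡_ _≡_ f⊎e
  f⊎e-injective {x} {y} with side h x | side h y
  ... | left a  | left a′ rewrite splitAt-↑ˡ h a (# (compl P)) | splitAt-↑ˡ h a′ (# (compl P)) =
    cong (_↑ˡ _) ∘ f-inj
  ... | left a  | right b rewrite splitAt-↑ˡ h a (# (compl P)) | splitAt-↑ʳ h (# (compl P)) b =
    λ eq → contradiction eq disjoint
  ... | right b | left a rewrite splitAt-↑ˡ h a (# (compl P)) | splitAt-↑ʳ h (# (compl P)) b =
    λ eq → contradiction (sym eq) disjoint
  ... | right b | right b′ rewrite splitAt-↑ʳ h (# (compl P)) b | splitAt-↑ʳ h (# (compl P)) b′ =
    cong (h ↑ʳ_) ∘ e-inj

-- Cuts, reachability and isomorphisms.

Symmetric : ∀ {N} → Graph N → Set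
Symmetric G = ∀ i j → G i j ≡ G j i

cross : ∀ {N} → Graph N → (Fin N → Bool) → Fin N → Fin N → Bool
cross G X x y = X x ∧ (not (X y) ∧ G x y)

cut≡sum : ∀ {N} (G : Graph N) X → cut G X ≡ sum (λ x → sum (λ y → ⟦ cross G X x y ⟧))
cut≡sum G X = #₂≡sum (cross G X)

cut-iso : ∀ {N M} {G : Graph N} {H : Graph M} ((φ , _) : Iso G H) X → cut G (X ∘ to φ) ≡ cut H X
cut-iso {G = G} {H} (φ , φ-hom) X = begin
  cut G (X ∘ to φ)
    ≡⟨ cut≡sum G (X ∘ to φ) ⟩
  sum (λ x → sum (λ y → ⟦ cross G (X ∘ to φ) x y ⟧))
    ≡⟨ sum-cong-≗ (λ x → sum-cong-≗ (λ y →
         cong (λ e → ⟦ X (to φ x) ∧ (not (X (to φ y)) ∧ e) ⟧) (φ-hom x y))) ⟩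
  sum (λ x → sum (λ y → ⟦ cross H X (to φ x) (to φ y) ⟧))
    ≡⟨ sum-cong-≗ (λ x → sum-⤖ φ (λ y → ⟦ cross H X (to φ x) y ⟧)) ⟩
  sum (λ x → sum (λ y → ⟦ cross H X (to φ x) y ⟧))
    ≡⟨ sum-⤖ φ (λ x → sum (λ y → ⟦ cross H X x y ⟧)) ⟩
  sum (λ x → sum (λ y → ⟦ cross H X x y ⟧))
    ≡⟨ cut≡sum H X ⟨
  cut H X ∎
  where open ≡-Reasoning

cut-cong : ∀ {N} (G : Graph N) {X Y} → (∀ x → X x ≡ Y x) → cut G X ≡ cut G Y
cut-cong G {X} {Y} p = trans (cut≡sum G X) (trans
  (sum-cong-≗ (λ x → sum-cong-≗ (λ y → cong₂ (λ b c → ⟦ b ∧ (not c ∧ G x y) ⟧) (p x) (p y))))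
  (sym (cut≡sum G Y)))

cut-const : ∀ {N} (G : Graph N) b → cut G (λ _ → b) ≡ 0
cut-const {N} G b = trans (sumFin≡sum (λ x → # (cross G (λ _ → b) x)))
  (sum≡0 (λ x → trans (#-cong (λ y → none b (G x y))) (#-false N)))
  where
  none : ∀ b e → b ∧ (not b ∧ e) ≡ false
  none true  e = refl
  none false e = refl
  sum≡0 : ∀ {N} {f : Fin N → ℕ} → (∀ i → f i ≡ 0) → sum f ≡ 0
  sum≡0 {zero}  p = refl
  sum≡0 {suc N} p = cong₂ _+_ (p zero) (sum≡0 (p ∘ suc))

module _ {N} {G : Graph N} {S : Fin N → Bool} where

  reach-start : ∀ {u v} → Reach G S u v → S u ≡ true
  reach-start (here p)      = p
  reach-start (there p _ _) = p

  reach-end : ∀ {u v} → Reach G S u v → S v ≡ true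
  reach-end (here p)      = p
  reach-end (there _ _ r) = reach-end r

  reach-trans : ∀ {u v w} → Reach G S u v → Reach G S v w → Reach G S u w
  reach-trans (here _)      s = s
  reach-trans (there p e r) s = there p e (reach-trans r s)

  reach-sym : Symmetric G → ∀ {u v} → Reach G S u v → Reach G S v u
  reach-sym G-sym (here p) = here p
  reach-sym G-sym (there {u} {w} p e r) =
    reach-trans (reach-sym G-sym r) (there (reach-start r) (trans (G-sym w u) e) (here p))

  reach-map : ∀ {M} {H : Graph M} {T : Fin M → Bool} (φ : Fin N → Fin M) →
    (∀ u → S u ≡ true → T (φ u) ≡ true) →
    (∀ u w → S u ≡ true → S w ≡ true → G u w ≡ true → H (φ u) (φ w) ≡ true) →
    ∀ {u v} → Reach G S u v → Reach H T (φ u) (φ v)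
  reach-map φ φ-S φ-G (here p)      = here (φ-S _ p)
  reach-map φ φ-S φ-G (there p e r) =
    there (φ-S _ p) (φ-G _ _ p (reach-start r) e) (reach-map φ φ-S φ-G r)

module _ {N M} {G : Graph N} {H : Graph M} (iso : Iso G H) where

  private
    φ : Fin N ⤖ Fin M
    φ = proj₁ iso

    φ-hom : ∀ i j → G i j ≡ H (to φ i) (to φ j)
    φ-hom = proj₂ iso

    ψ : Fin M ⤖ Fin N
    ψ = sym-≡ φ

    φψ : ∀ y → to φ (to ψ y) ≡ y
    φψ = Inverse.strictlyInverseˡ (⤖⇒↔ φ)

    ψφ : ∀ x → to ψ (to φ x) ≡ x
    ψφ = Inverse.strictlyInverseʳ (⤖⇒↔ φ)

  Iso-sym : Iso H G
  Iso-sym = ψ , λ i j → sym (trans (φ-hom (to ψ i) (to ψ j)) (cong₂ H (φψ i) (φψ j)))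

  Connected-iso : ∀ S → Connected H S → Connected G (S ∘ to φ)
  Connected-iso S conn u v u∈S v∈S =
    subst₂ (Reach G (S ∘ to φ)) (ψφ u) (ψφ v)
      (reach-map (to ψ)
        (λ y y∈S → trans (cong S (φψ y)) y∈S)
        (λ y z _ _ e → trans (sym (proj₂ Iso-sym y z)) e)
        (conn (to φ u) (to φ v) u∈S v∈S))

-- The inductive invariant of K₄-hypercubes.

-- Everything the final argument takes from membership in `H4`, in a form that survives joins.
-- `subcube` starts at k = 2 because its formula fails inside `K4`: two vertices have boundary 4,
-- not 2.
record CubeLike (n : ℕ) {N : ℕ} (G : Graph N) : Set where
  field
    order     : N ≡ 2 ^ n
    symmetric : Symmetric G
    connected : Connected G allV
    cut-bound : ∀ X → τ n (# X) + δ (# X) ≤ cut G X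
    subcube   : ∀ k → 2 ≤ k → k ≤ n → Σ (Fin N → Bool) λ X →
      # X ≡ 2 ^ k × Connected G X × Connected G (compl X) × cut G X ≡ (n ∸ k) * 2 ^ k

open CubeLike

CubeLike-iso : ∀ {n N} {G H : Graph N} → Iso G H → CubeLike n G → CubeLike n H
CubeLike-iso {n} {G = G} {H} iso@(φ , φ-hom) good = record
  { order     = order good
  ; symmetric = λ i j → trans (ψ-hom i j) (trans (symmetric good _ _) (sym (ψ-hom j i)))
  ; connected = Connected-iso iso⁻¹ allV (connected good)
  ; cut-bound = λ X → subst₂ (λ m c → τ n m + δ m ≤ c) (#-⤖ φ X) (cut-iso iso X)
                        (cut-bound good (X ∘ to φ))
  ; subcube   = λ k 2≤k k≤n → let X , #X , X-conn , Xᶜ-conn , cut≡ = subcube good k 2≤k k≤n in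
      X ∘ to (proj₁ iso⁻¹)
      , trans (#-⤖ (proj₁ iso⁻¹) X) #X
      , Connected-iso iso⁻¹ X X-conn
      , Connected-iso iso⁻¹ (compl X) Xᶜ-conn
      , trans (cut-iso iso⁻¹ X) cut≡
  }
  where
  iso⁻¹ = Iso-sym iso
  ψ-hom = proj₂ iso⁻¹

CubeLike-K4 : CubeLike 2 K4
CubeLike-K4 = record
  { order     = refl
  ; symmetric = λ i j → cong not (does-sym i j)
  ; connected = complete allV
  ; cut-bound = bound
  ; subcube   = λ { k 2≤k k≤2 → whole k (≤-antisym 2≤k k≤2) }
  }
  where
  does-sym : ∀ {n} (i j : Fin n) → does (i ≟ j) ≡ does (j ≟ i)
  does-sym i j with i ≟ j
  ... | yes p = sym (dec-true (j ≟ i) (sym p))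
  ... | no ¬p = sym (dec-false (j ≟ i) (¬p ∘ sym))
  complete : ∀ S → Connected K4 S
  complete S u v u∈S v∈S with u ≟ v
  ... | yes refl = here u∈S
  ... | no u≢v   = there u∈S (cong not (dec-false (u ≟ v) u≢v)) (here v∈S)
  bound : ∀ X → τ 2 (# X) + δ (# X) ≤ cut K4 X
  -- The sixteen subsets are decided by evaluation; equality holds in each, by the choice of `δ`.
  bound X with X zero | X (suc zero) | X (suc (suc zero)) | X (suc (suc (suc zero)))
  ... | true  | true  | true  | true  = ≤ᵇ⇒≤ _ _ tt
  ... | true  | true  | true  | false = ≤ᵇ⇒≤ _ _ tt
  ... | true  | true  | false | true  = ≤ᵇ⇒≤ _ _ tt
  ... | true  | true  | false | false = ≤ᵇ⇒≤ _ _ tt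
  ... | true  | false | true  | true  = ≤ᵇ⇒≤ _ _ tt
  ... | true  | false | true  | false = ≤ᵇ⇒≤ _ _ tt
  ... | true  | false | false | true  = ≤ᵇ⇒≤ _ _ tt
  ... | true  | false | false | false = ≤ᵇ⇒≤ _ _ tt
  ... | false | true  | true  | true  = ≤ᵇ⇒≤ _ _ tt
  ... | false | true  | true  | false = ≤ᵇ⇒≤ _ _ tt
  ... | false | true  | false | true  = ≤ᵇ⇒≤ _ _ tt
  ... | false | true  | false | false = ≤ᵇ⇒≤ _ _ tt
  ... | false | false | true  | true  = ≤ᵇ⇒≤ _ _ tt
  ... | false | false | true  | false = ≤ᵇ⇒≤ _ _ tt
  ... | false | false | false | true  = ≤ᵇ⇒≤ _ _ tt
  ... | false | false | false | false = ≤ᵇ⇒≤ _ _ tt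
  whole : ∀ k → 2 ≡ k → Σ (Fin 4 → Bool) λ X →
    # X ≡ 2 ^ k × Connected K4 X × Connected K4 (compl X) × cut K4 X ≡ (2 ∸ k) * 2 ^ k
  whole _ refl = allV , refl , complete allV , complete (compl allV) , refl

-- Joining two graphs along a perfect matching.

#₂-split : ∀ N₀ {N₁} (P : Fin (N₀ + N₁) → Fin (N₀ + N₁) → Bool) →
  #₂ P ≡ (sum (λ a → # (λ a′ → P (a ↑ˡ N₁) (a′ ↑ˡ N₁))) + sum (λ a → # (λ b → P (a ↑ˡ N₁) (N₀ ↑ʳ b))))
       + (sum (λ b → # (λ a → P (N₀ ↑ʳ b) (a ↑ˡ N₁))) + sum (λ b → # (λ b′ → P (N₀ ↑ʳ b) (N₀ ↑ʳ b′))))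
#₂-split N₀ {N₁} P = begin
  #₂ P
    ≡⟨ sumFin≡sum (λ x → # (P x)) ⟩
  sum (λ x → # (P x))
    ≡⟨ sum-split N₀ (λ x → # (P x)) ⟩
  sum (λ a → # (P (a ↑ˡ N₁))) + sum (λ b → # (P (N₀ ↑ʳ b)))
    ≡⟨ cong₂ _+_ (halves (_↑ˡ N₁)) (halves (N₀ ↑ʳ_)) ⟩
  _ ∎
  where
  open ≡-Reasoning
  halves : ∀ {K} (ι : Fin K → Fin (N₀ + N₁)) → sum (λ i → # (P (ι i))) ≡
    sum (λ i → # (λ a → P (ι i) (a ↑ˡ N₁))) + sum (λ i → # (λ b → P (ι i) (N₀ ↑ʳ b)))
  halves ι = trans (sum-cong-≗ (λ i → #-split N₀ (P (ι i))))
    (∑-distrib-+ (λ i → # (λ a → P (ι i) (a ↑ˡ N₁))) (λ i → # (λ b → P (ι i) (N₀ ↑ʳ b))))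

module _ {N₀ N₁} (G₀ : Graph N₀) (G₁ : Graph N₁) (M : Fin N₀ ⤖ Fin N₁) where

  private
    J = join G₀ G₁ M
    l : Fin N₀ → Fin (N₀ + N₁)
    l = _↑ˡ N₁
    r : Fin N₁ → Fin (N₀ + N₁)
    r = N₀ ↑ʳ_
    μ = to M

  join-ll : ∀ a a′ → J (l a) (l a′) ≡ G₀ a a′
  join-ll a a′ rewrite splitAt-↑ˡ N₀ a N₁ | splitAt-↑ˡ N₀ a′ N₁ = refl

  join-lr : ∀ a b → J (l a) (r b) ≡ does (b ≟ μ a)
  join-lr a b rewrite splitAt-↑ˡ N₀ a N₁ | splitAt-↑ʳ N₀ N₁ b = refl

  join-rl : ∀ b a → J (r b) (l a) ≡ does (b ≟ μ a)
  join-rl b a rewrite splitAt-↑ʳ N₀ N₁ b | splitAt-↑ˡ N₀ a N₁ = refl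

  join-rr : ∀ b b′ → J (r b) (r b′) ≡ G₁ b b′
  join-rr b b′ rewrite splitAt-↑ʳ N₀ N₁ b | splitAt-↑ʳ N₀ N₁ b′ = refl

  join-symmetric : Symmetric G₀ → Symmetric G₁ → Symmetric J
  join-symmetric s₀ s₁ i j with side N₀ i | side N₀ j
  ... | left a  | left a′  = trans (join-ll a a′) (trans (s₀ a a′) (sym (join-ll a′ a)))
  ... | left a  | right b  = trans (join-lr a b) (sym (join-rl b a))
  ... | right b | left a   = trans (join-rl b a) (sym (join-lr a b))
  ... | right b | right b′ = trans (join-rr b b′) (trans (s₁ b b′) (sym (join-rr b′ b)))

  -- For fixed a only b = `μ a` contributes, so the double count collapses to one over a.
  #-matching : ∀ (A : Fin N₀ → Bool) (B : Fin N₁ → Bool) →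
    sum (λ a → # (λ b → A a ∧ (B b ∧ does (b ≟ μ a)))) ≡ # (λ a → A a ∧ B (μ a))
  #-matching A B = trans
    (sum-cong-≗ (λ a → trans (#-cong (λ b → sym (∧-assoc (A a) (B b) _)))
                             (#-singleton (λ b → A a ∧ B b) (μ a))))
    (sym (#≡sum (λ a → A a ∧ B (μ a))))

  cut-join : ∀ X → let X₀ = X ∘ l ; X₁ = X ∘ r in
    cut J X ≡ (cut G₀ X₀ + # (λ a → X₀ a ∧ not (X₁ (μ a))))
            + (# (λ a → X₁ (μ a) ∧ not (X₀ a)) + cut G₁ X₁)
  cut-join X = trans (#₂-split N₀ _) (cong₂ _+_ (cong₂ _+_ ll lr) (cong₂ _+_ rl rr))
    where
    X₀ = X ∘ l
    X₁ = X ∘ r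
    ll : sum (λ a → # (λ a′ → cross J X (l a) (l a′))) ≡ cut G₀ X₀
    ll = trans (sum-cong-≗ (λ a → #-cong (λ a′ →
           cong (λ e → X₀ a ∧ (not (X₀ a′) ∧ e)) (join-ll a a′)))) (sym (sumFin≡sum (λ a → # (cross G₀ X₀ a))))
    rr : sum (λ b → # (λ b′ → cross J X (r b) (r b′))) ≡ cut G₁ X₁
    rr = trans (sum-cong-≗ (λ b → #-cong (λ b′ →
           cong (λ e → X₁ b ∧ (not (X₁ b′) ∧ e)) (join-rr b b′)))) (sym (sumFin≡sum (λ b → # (cross G₁ X₁ b))))
    lr : sum (λ a → # (λ b → cross J X (l a) (r b))) ≡ # (λ a → X₀ a ∧ not (X₁ (μ a)))
    lr = trans (sum-cong-≗ (λ a → #-cong (λ b →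
           cong (λ e → X₀ a ∧ (not (X₁ b) ∧ e)) (join-lr a b)))) (#-matching X₀ (compl X₁))
    rl : sum (λ b → # (λ a → cross J X (r b) (l a))) ≡ # (λ a → X₁ (μ a) ∧ not (X₀ a))
    rl = begin
      sum (λ b → # (λ a → cross J X (r b) (l a)))
        ≡⟨ sum-cong-≗ (λ b → #≡sum (λ a → cross J X (r b) (l a))) ⟩
      sum (λ b → sum (λ a → ⟦ cross J X (r b) (l a) ⟧))
        -- Exchanging the sums makes the inner one run over b, where the matching has a single
        -- entry.
        ≡⟨ ∑-comm (λ b a → ⟦ cross J X (r b) (l a) ⟧) ⟩
      sum (λ a → sum (λ b → ⟦ cross J X (r b) (l a) ⟧))
        ≡⟨ sum-cong-≗ (λ a → #≡sum (λ b → cross J X (r b) (l a))) ⟨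
      sum (λ a → # (λ b → cross J X (r b) (l a)))
        ≡⟨ sum-cong-≗ (λ a → #-cong (λ b → trans
             (cong (λ e → X₁ b ∧ (not (X₀ a) ∧ e)) (join-rl b a))
             (∧-rotate (X₁ b) (not (X₀ a)) (does (b ≟ μ a))))) ⟩
      sum (λ a → # (λ b → not (X₀ a) ∧ (X₁ b ∧ does (b ≟ μ a))))
        ≡⟨ #-matching (compl X₀) X₁ ⟩
      # (λ a → not (X₀ a) ∧ X₁ (μ a))
        ≡⟨ #-cong (λ a → ∧-comm (not (X₀ a)) (X₁ (μ a))) ⟩
      # (λ a → X₁ (μ a) ∧ not (X₀ a)) ∎
      where
      open ≡-Reasoning
      ∧-rotate : ∀ x y z → x ∧ (y ∧ z) ≡ y ∧ (x ∧ z)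
      ∧-rotate true  y     z = refl
      ∧-rotate false true  z = refl
      ∧-rotate false false z = refl

  join-cut-bound : ∀ n →
    (∀ X → τ n (# X) + δ (# X) ≤ cut G₀ X) → (∀ X → τ n (# X) + δ (# X) ≤ cut G₁ X) →
    ∀ X → τ (suc n) (# X) + δ (# X) ≤ cut J X
  join-cut-bound n bound₀ bound₁ X = begin
    τ (suc n) (# X) + δ (# X)
      ≡⟨ cong (λ m → τ (suc n) m + δ m) (#-split N₀ X) ⟩
    τ (suc n) (a + b) + δ (a + b)
      ≤⟨ +-mono-≤ (τ-subadd n a b) (δ-subadd a b) ⟩
    (τ n a + τ n b + ∣ a - b ∣) + (δ a + δ b)
      ≤⟨ +-monoˡ-≤ (δ a + δ b) (+-monoʳ-≤ (τ n a + τ n b) ∣a-b∣≤) ⟩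
    (τ n a + τ n b + (p + q)) + (δ a + δ b)
      ≡⟨ rearrange (τ n a) (τ n b) (δ a) (δ b) p q ⟩
    ((τ n a + δ a) + p) + (q + (τ n b + δ b))
      ≤⟨ +-mono-≤ (+-monoˡ-≤ p (bound₀ (X ∘ l))) (+-monoʳ-≤ q (bound₁ (X ∘ r))) ⟩
    (cut G₀ (X ∘ l) + p) + (q + cut G₁ (X ∘ r))
      ≡⟨ cut-join X ⟨
    cut J X ∎
    where
    open ≤-Reasoning
    a = # (X ∘ l)
    b = # (X ∘ r)
    p = # (λ i → X (l i) ∧ not (X (r (μ i))))
    q = # (λ i → X (r (μ i)) ∧ not (X (l i)))
    ∣a-b∣≤ : ∣ a - b ∣ ≤ p + q
    -- The right half of X is pulled back along M, which preserves its size, so that both sets live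
    -- on `Fin N₀`.
    ∣a-b∣≤ = subst (λ z → ∣ a - z ∣ ≤ p + q) (#-⤖ M (X ∘ r)) (∣#-#∣≤ (X ∘ l) (X ∘ r ∘ μ))
    rearrange : ∀ s t u v p q → (s + t + (p + q)) + (u + v) ≡ ((s + u) + p) + (q + (t + v))
    rearrange = solve-∀

  -- Every left vertex of S steps along its matching edge into the right half, which is connected. A
  -- general S covers both the whole graph and the complement of a set contained in the left half.
  join-connected : Symmetric J → Connected G₁ allV → ∀ S → (∀ b → S (r b) ≡ true) → Connected J S
  join-connected J-sym conn₁ S r∈S u v u∈S v∈S with to-right u u∈S | to-right v v∈S
    where
    to-right : ∀ u → S u ≡ true → ∃ λ b → Reach J S u (r b)
    to-right u u∈S with side N₀ u
    ... | right b = b , here u∈S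
    ... | left a  = μ a , there u∈S (trans (join-lr a (μ a)) (dec-true (μ a ≟ μ a) refl)) (here (r∈S (μ a)))
  ... | b , u⇝b | b′ , v⇝b′ = reach-trans u⇝b (reach-trans
    (reach-map r (λ b _ → r∈S b) (λ b b′ _ _ e → trans (join-rr b b′) e) (conn₁ b b′ refl refl))
    (reach-sym J-sym v⇝b′))

  extend : (Fin N₀ → Bool) → Fin (N₀ + N₁) → Bool
  extend X x = [ X , (λ _ → false) ]′ (splitAt N₀ x)

  extend-l : ∀ X a → extend X (l a) ≡ X a
  extend-l X a = cong [ X , (λ _ → false) ]′ (splitAt-↑ˡ N₀ a N₁)

  extend-r : ∀ X b → extend X (r b) ≡ false
  extend-r X b = cong [ X , (λ _ → false) ]′ (splitAt-↑ʳ N₀ N₁ b)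

  #-extend : ∀ X → # (extend X) ≡ # X
  #-extend X = trans (#-split N₀ (extend X)) (trans
    (cong₂ _+_ (#-cong (extend-l X)) (trans (#-cong (extend-r X)) (#-false N₁)))
    (+-identityʳ (# X)))

  extend-connected : ∀ X → Connected G₀ X → Connected J (extend X)
  extend-connected X conn u v u∈ v∈ with side N₀ u | side N₀ v
  ... | left a  | left a′ =
    reach-map l (λ a a∈ → trans (extend-l X a) a∈) (λ a a′ _ _ e → trans (join-ll a a′) e)
      (conn a a′ (trans (sym (extend-l X a)) u∈) (trans (sym (extend-l X a′)) v∈))
  ... | right b | _       with () ← trans (sym (extend-r X b)) u∈
  ... | left _  | right b with () ← trans (sym (extend-r X b)) v∈

  cut-extend : ∀ X → cut J (extend X) ≡ cut G₀ X + # X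
  cut-extend X = begin
    cut J (extend X)
      ≡⟨ cut-join (extend X) ⟩
    (cut G₀ (extend X ∘ l) + # (λ a → extend X (l a) ∧ not (extend X (r (μ a)))))
      + (# (λ a → extend X (r (μ a)) ∧ not (extend X (l a))) + cut G₁ (extend X ∘ r))
      ≡⟨ cong₂ _+_
           (cong₂ _+_ (cut-cong G₀ (extend-l X))
             (#-cong (λ a → trans (cong₂ (λ x y → x ∧ not y) (extend-l X a) (extend-r X (μ a)))
                                  (∧-identityʳ (X a)))))
           (cong₂ _+_ (trans (#-cong (λ a → cong (_∧ not (extend X (l a))) (extend-r X (μ a)))) (#-false N₀))
             (trans (cut-cong G₁ (extend-r X)) (cut-const G₁ false))) ⟩
    (cut G₀ X + # X) + 0
      ≡⟨ +-identityʳ _ ⟩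
    cut G₀ X + # X ∎
    where open ≡-Reasoning

  CubeLike-join : ∀ {n} → CubeLike n G₀ → CubeLike n G₁ → CubeLike (suc n) J
  CubeLike-join {n} good₀ good₁ = record
    { order     = order′
    ; symmetric = J-sym
    ; connected = J-conn
    ; cut-bound = join-cut-bound n (cut-bound good₀) (cut-bound good₁)
    ; subcube   = sub
    }
    where
    order′ = trans (cong₂ _+_ (order good₀) (order good₁)) (sym (2^-suc n))
    J-sym = join-symmetric (symmetric good₀) (symmetric good₁)
    J-conn = join-connected J-sym (connected good₁) allV (λ _ → refl)
    sub : ∀ k → 2 ≤ k → k ≤ suc n → Σ (Fin (N₀ + N₁) → Bool) λ X →
      # X ≡ 2 ^ k × Connected J X × Connected J (compl X) × cut J X ≡ (suc n ∸ k) * 2 ^ k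
    sub k 2≤k k≤1+n with m≤n⇒m<n∨m≡n k≤1+n
    -- The top dimension is the whole vertex set; its complement is empty and vacuously connected.
    ... | inj₂ refl = allV , trans (#-true (N₀ + N₁)) order′ , J-conn , (λ _ _ ())
                    , trans (cut-const J true) (cong (_* 2 ^ k) (sym (n∸n≡0 n)))
    ... | inj₁ (s≤s k≤n) with subcube good₀ k 2≤k k≤n
    ... | X , #X , X-conn , _ , cut≡ =
        extend X
      , trans (#-extend X) #X
      , extend-connected X X-conn
      , join-connected J-sym (connected good₁) (compl (extend X)) (λ b → cong not (extend-r X b))
      , (begin
          cut J (extend X)             ≡⟨ cut-extend X ⟩
          cut G₀ X + # X               ≡⟨ cong₂ _+_ cut≡ #X ⟩
          (n ∸ k) * 2 ^ k + 2 ^ k      ≡⟨ +-comm _ (2 ^ k) ⟩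
          suc (n ∸ k) * 2 ^ k          ≡⟨ cong (_* 2 ^ k) (+-∸-assoc 1 k≤n) ⟨
          (suc n ∸ k) * 2 ^ k          ∎)
      where open ≡-Reasoning

H4⇒CubeLike : ∀ {n N G} → H4 n N G → CubeLike n G
H4⇒CubeLike (base iso) = CubeLike-iso iso CubeLike-K4
H4⇒CubeLike (step {G0 = G₀} {G₁} h₀ h₁ M iso) =
  CubeLike-iso iso (CubeLike-join G₀ G₁ M (H4⇒CubeLike h₀) (H4⇒CubeLike h₁))

-- Extra edge cuts and the boundaries of vertex sets.

boundary : ∀ {N} → Graph N → (Fin N → Bool) → Fin N → Fin N → Bool
boundary G X i j = G i j ∧ (X i xor X j)

_<ᶠ_ : ∀ {N} → Fin N → Fin N → Bool
i <ᶠ j = toℕ i <ᵇ toℕ j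

module _ {N} (G : Graph N) (G-sym : Symmetric G) where

  cross-orient : ∀ X i j →
    ⟦ cross G X i j ⟧ ≡ ⟦ i <ᶠ j ∧ cross G X i j ⟧ + ⟦ j <ᶠ i ∧ cross G X i j ⟧
  cross-orient X i j with toℕ i <ᵇ toℕ j in i<j | toℕ j <ᵇ toℕ i in j<i
  ... | true  | true  = contradiction (<ᵇ⇒< (toℕ i) (toℕ j) (subst T (sym i<j) tt))
                          (<-asym (<ᵇ⇒< (toℕ j) (toℕ i) (subst T (sym j<i) tt)))
  ... | true  | false = sym (+-identityʳ _)
  ... | false | true  = refl
  ... | false | false = cong ⟦_⟧ (trans (cong (cross G X i) (sym i≡j)) (loop (X i)))
    where
    i≡j : i ≡ j
    i≡j = toℕ-injective (≤-antisym (≮⇒≥ (λ q → subst T j<i (<⇒<ᵇ q)))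
                                   (≮⇒≥ (λ q → subst T i<j (<⇒<ᵇ q))))
    loop : ∀ b → b ∧ (not b ∧ G i i) ≡ false
    loop true  = refl
    loop false = refl

  -- `cut` counts pairs ordered from inside to outside, `edgeCount` pairs with i < j. The former are
  -- split by orientation, the decreasing ones transposed, and the two parts merged.
  edgeCount-boundary : ∀ X → edgeCount (boundary G X) ≡ cut G X
  edgeCount-boundary X = sym (begin
    cut G X
      ≡⟨ cut≡sum G X ⟩
    sum (λ i → sum (λ j → ⟦ cross G X i j ⟧))
      ≡⟨ sum-cong-≗ (λ i → trans (sum-cong-≗ (cross-orient X i)) (∑-distrib-+ (up i) (down i))) ⟩
    sum (λ i → sum (up i) + sum (down i))
      ≡⟨ ∑-distrib-+ (λ i → sum (up i)) (λ i → sum (down i)) ⟩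
    sum (λ i → sum (up i)) + sum (λ i → sum (down i))
      ≡⟨ cong (sum (λ i → sum (up i)) +_) (∑-comm down) ⟩
    sum (λ i → sum (up i)) + sum (λ j → sum (λ i → down i j))
      ≡⟨ ∑-distrib-+ (λ i → sum (up i)) (λ j → sum (λ i → down i j)) ⟨
    sum (λ i → sum (up i) + sum (λ j → down j i))
      ≡⟨ sum-cong-≗ (λ i → trans (sym (∑-distrib-+ (up i) (λ j → down j i)))
                                 (sum-cong-≗ (merge i))) ⟩
    sum (λ i → sum (λ j → ⟦ i <ᶠ j ∧ boundary G X i j ⟧))
      ≡⟨ #₂≡sum (λ i j → i <ᶠ j ∧ boundary G X i j) ⟨
    edgeCount (boundary G X) ∎)
    where
    open ≡-Reasoning
    up down : Fin N → Fin N → ℕ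
    up   i j = ⟦ i <ᶠ j ∧ cross G X i j ⟧
    down i j = ⟦ j <ᶠ i ∧ cross G X i j ⟧
    table : ∀ o x y e → ⟦ o ∧ (x ∧ (not y ∧ e)) ⟧ + ⟦ o ∧ (y ∧ (not x ∧ e)) ⟧ ≡ ⟦ o ∧ (e ∧ (x xor y)) ⟧
    table false x     y     e     = refl
    table true  true  true  true  = refl
    table true  true  true  false = refl
    table true  true  false true  = refl
    table true  true  false false = refl
    table true  false true  true  = refl
    table true  false true  false = refl
    table true  false false true  = refl
    table true  false false false = refl
    merge : ∀ i j → up i j + down j i ≡ ⟦ i <ᶠ j ∧ boundary G X i j ⟧
    merge i j = trans (cong (λ e → up i j + ⟦ i <ᶠ j ∧ (X j ∧ (not (X i) ∧ e)) ⟧) (G-sym j i))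
                      (table (i <ᶠ j) (X i) (X j) (G i j))

  boundary-isEdgeSet : ∀ X → IsEdgeSet G (boundary G X)
  boundary-isEdgeSet X = (λ i j → cong₂ _∧_ (G-sym i j) (xor-comm (X i) (X j)))
                       , (λ i j → ∧-left (G i j))
    where
    ∧-left : ∀ x {y} → x ∧ y ≡ true → x ≡ true
    ∧-left true _ = refl

  delete-boundary-side : ∀ X {S u v} → Reach (delete G (boundary G X)) S u v → X u ≡ X v
  delete-boundary-side X (here _) = refl
  delete-boundary-side X (there {u} {w} _ e r) =
    trans (kept (G u w) (X u) (X w) e) (delete-boundary-side X r)
    where
    kept : ∀ e x y → e ∧ not (e ∧ (x xor y)) ≡ true → x ≡ y
    kept true true  true  _ = refl
    kept true false false _ = refl

  delete-boundary-reach : ∀ X Y → (∀ u w → Y u ≡ true → Y w ≡ true → X u ≡ X w) →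
    ∀ {u v} → Reach G Y u v → Reach (delete G (boundary G X)) allV u v
  delete-boundary-reach X Y same = reach-map (λ u → u) (λ _ _ → refl)
    (λ u w u∈ w∈ e → keep (G u w) (X u) (X w) e (same u w u∈ w∈))
    where
    keep : ∀ e x y → e ≡ true → x ≡ y → e ∧ not (e ∧ (x xor y)) ≡ true
    keep true true  .true  _ refl = refl
    keep true false .false _ refl = refl

  boundary-isExtraCut : ∀ {h} X → 1 ≤ h → h ≤ # X → h ≤ # (compl X) →
    Connected G X → Connected G (compl X) → IsExtraCut h G (boundary G X)
  boundary-isExtraCut {h} X 1≤h h≤ h≤ᶜ conn connᶜ
    with ≤#⇒injection X h≤ | ≤#⇒injection (compl X) h≤ᶜ
  ... | f , f-inj , f∈X | f′ , f′-inj , f′∉X = (f i₀ , f′ i₀ , separated) , component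
    where
    i₀ : Fin h
    -- h ≥ 1 supplies a vertex on each side; these two are separated.
    i₀ = inject≤ zero 1≤h
    ¬true : ∀ {b} → not b ≡ true → b ≡ false
    ¬true {false} _ = refl
    separated : ¬ Reach (delete G (boundary G X)) allV (f i₀) (f′ i₀)
    separated r with () ← trans (sym (f∈X i₀)) (trans (delete-boundary-side X r) (¬true (f′∉X i₀)))
    component : ∀ v → Σ (Fin h → Fin N) λ f →
      Injective _≡_ _≡_ f × (∀ i → Reach (delete G (boundary G X)) allV v (f i))
    component v with X v in eq
    ... | true  = f , f-inj , λ i → delete-boundary-reach X X
                    (λ _ _ u∈ w∈ → trans u∈ (sym w∈)) (conn v (f i) eq (f∈X i))
    ... | false = f′ , f′-inj , λ i → delete-boundary-reach X (compl X)
                    (λ _ _ u∉ w∉ → trans (¬true u∉) (sym (¬true w∉))) (connᶜ v (f′ i) (cong not eq) (f′∉X i))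

  cut≤edgeCount : ∀ X F → (∀ i j → boundary G X i j ≡ true → F i j ≡ true) → cut G X ≤ edgeCount F
  cut≤edgeCount X F sub = begin
    cut G X                                                   ≡⟨ edgeCount-boundary X ⟨
    edgeCount (boundary G X)                                  ≡⟨ #₂≡sum (λ i j → i <ᶠ j ∧ boundary G X i j) ⟩
    sum (λ i → sum (λ j → ⟦ i <ᶠ j ∧ boundary G X i j ⟧))     ≤⟨ sum-mono (λ i → sum-mono (λ j → mono (i <ᶠ j) (sub i j))) ⟩
    sum (λ i → sum (λ j → ⟦ i <ᶠ j ∧ F i j ⟧))                ≡⟨ #₂≡sum (λ i j → i <ᶠ j ∧ F i j) ⟨
    edgeCount F ∎
    where
    open ≤-Reasoning
    mono : ∀ o {x y} → (x ≡ true → y ≡ true) → ⟦ o ∧ x ⟧ ≤ ⟦ o ∧ y ⟧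
    mono false         _ = z≤n
    mono true  {false} _ = z≤n
    mono true  {true}  p = ≤-reflexive (cong ⟦_⟧ (sym (p refl)))

  -- The vertices reachable from u form the set X; this is decidable only up to double negation.
  extraCut⇒cut : ∀ {h} F → IsEdgeSet G F → IsExtraCut h G F →
    ¬ ¬ (∃ λ X → h ≤ # X × h ≤ # (compl X) × cut G X ≤ edgeCount F)
  extraCut⇒cut {h} F (F-sym , _) ((u , v , u↛v) , component) =
    -- Each instance of excluded middle holds under double negation, and `sequence` collects the
    -- finitely many instances into one.
    ¬¬-map from-dec (sequence (RawMonad.rawApplicative ¬¬-Monad) (λ w → ¬¬-excluded-middle))
    where
    G∖F = delete G F
    G∖F-sym : Symmetric G∖F
    G∖F-sym i j = cong₂ (λ e d → e ∧ not d) (G-sym i j) (F-sym i j)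
    from-dec : (∀ w → Dec (Reach G∖F allV u w)) →
      ∃ λ X → h ≤ # X × h ≤ # (compl X) × cut G X ≤ edgeCount F
    from-dec reach? = X , h≤X , h≤Xᶜ , cut≤edgeCount X F boundary⊆F
      where
      X : Fin N → Bool
      X w = does (reach? w)
      h≤X : h ≤ # X
      h≤X with component u
      ... | f , f-inj , u⇝f = injection⇒≤# X f f-inj (λ i → dec-true (reach? (f i)) (u⇝f i))
      h≤Xᶜ : h ≤ # (compl X)
      h≤Xᶜ with component v
      ... | f , f-inj , v⇝f = injection⇒≤# (compl X) f f-inj (λ i → cong not (dec-false (reach? (f i))
              (λ u⇝f → u↛v (reach-trans u⇝f (reach-sym G∖F-sym (v⇝f i))))))
      boundary⊆F : ∀ i j → boundary G X i j ≡ true → F i j ≡ true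
      -- An edge outside F would extend reachability from u across the boundary of X.
      boundary⊆F i j e with F i j in Fij | reach? i | reach? j | G i j in Gij
      ... | true  | _      | _      | _    = refl
      ... | false | yes u⇝i | no u↛j | true =
        contradiction (reach-trans u⇝i (there refl (cong₂ (λ e d → e ∧ not d) Gij Fij) (here refl))) u↛j
      ... | false | no u↛i | yes u⇝j | true =
        contradiction (reach-trans u⇝j (there refl (trans (G∖F-sym j i) (cong₂ (λ e d → e ∧ not d) Gij Fij)) (here refl))) u↛i

-- Combining the bounds.

gap-suc<2^ : ∀ p → gap (suc p) < 2 ^ (2 + p)
gap-suc<2^ zero    = ≤-refl
gap-suc<2^ (suc p) = subst (gap (2 + p) <_) (sym (2^-suc (2 + p)))
  (+-monoʳ-< (2 ^ (2 + p)) (≤-<-trans (gap≤2^ p) (^-monoʳ-< 2 (s≤s (s≤s z≤n)) (n<1+n (suc p)))))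

-- Ensures that 2^k - `gap p` is positive, hence h ≥ 1. At p = 0 the threshold equals 2, so
-- strictness rests on k ≥ 2.
gap<2^ : ∀ j p → 2 ≤ suc j + p → gap p < 2 ^ (suc j + p)
gap<2^ zero    zero    (s≤s ())
gap<2^ (suc j) zero    _ = ≤-trans (n≤1+n 3) (^-monoʳ-≤ 2 {2} {2 + j + 0} (s≤s (s≤s z≤n)))
gap<2^ j       (suc p) _ = <-≤-trans (gap-suc<2^ p) (^-monoʳ-≤ 2 (s≤s (m≤n+m (suc p) j)))

-- The theorem in parameters free of subtraction and rounding. The boundary of a subcube of
-- dimension k attains both minima, and `cut-lower` with `cut-bound` bounds every competitor.
power-cut : ∀ j p {h N} {G : Graph N} → let k = suc j + p ; n = suc j + k in
  2 ≤ k → CubeLike n G → 2 ^ k ∸ gap p ≤ h → h ≤ 2 ^ k →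
  IsLambda h G (suc j * 2 ^ k) × IsXi (2 ^ k) G (suc j * 2 ^ k)
power-cut j p {h} {N} {G} 2≤k good h≥ h≤ with subcube good (suc j + p) 2≤k (m≤n+m (suc j + p) (suc j))
... | X , #X , X-conn , Xᶜ-conn , cut≡ =
    ( ( boundary G X , boundary-isEdgeSet G G-sym X
      , boundary-isExtraCut G G-sym X 1≤h (subst (h ≤_) (sym #X) h≤) (≤-trans h≤ 2^k≤Xᶜ) X-conn Xᶜ-conn
      , trans (edgeCount-boundary G G-sym X) cut≡′ )
    -- The inequality between natural numbers is decidable, so the double negation can be removed.
    , λ F F-edges F-cut → decidable-stable (suc j * 2 ^ k ≤? edgeCount F)
        (¬¬-map (λ { (Y , h≤Y , h≤Yᶜ , cut≤) →
                     ≤-trans (lower Y (large h≤Y) (large h≤Yᶜ)) cut≤ })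
                (extraCut⇒cut G G-sym F F-edges F-cut)) )
  , ( (X , #X , X-conn , Xᶜ-conn , cut≡′)
    , λ Y #Y _ _ → lower Y (≤-trans (≤-reflexive (sym #Y)) (m≤m+n _ _))
                           (≤-trans (co-large Y #Y) (m≤m+n _ _)) )
  where
  k = suc j + p
  n = suc j + k
  G-sym = symmetric good
  cut≡′ : cut G X ≡ suc j * 2 ^ k
  cut≡′ = trans cut≡ (cong (_* 2 ^ k) (m+n∸n≡m (suc j) k))
  #+#ᶜ : ∀ Y → # Y + # (compl Y) ≡ 2 ^ n
  #+#ᶜ Y = trans (#-compl Y) (order good)
  lower : ∀ Y → 2 ^ k ≤ # Y + gap p → 2 ^ k ≤ # (compl Y) + gap p → suc j * 2 ^ k ≤ cut G Y
  lower Y p₁ p₂ = ≤-trans (cut-lower j p 2≤k (#+#ᶜ Y) p₁ p₂) (cut-bound good Y)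
  large : ∀ {m} → h ≤ m → 2 ^ k ≤ m + gap p
  large {m} h≤m = ≤-trans (m≤n+m∸n (2 ^ k) (gap p))
    (≤-trans (+-monoʳ-≤ (gap p) (≤-trans h≥ h≤m)) (≤-reflexive (+-comm (gap p) m)))
  -- Since n > k, the 2^n vertices leave at least 2^k outside Y.
  co-large : ∀ Y → # Y ≡ 2 ^ k → 2 ^ k ≤ # (compl Y)
  co-large Y #Y = +-cancelˡ-≤ (2 ^ k) _ _ (begin
    2 ^ k + 2 ^ k           ≡⟨ 2^-suc k ⟨
    2 ^ suc k               ≤⟨ ^-monoʳ-≤ 2 (s≤s (m≤n+m k j)) ⟩
    2 ^ n                   ≡⟨ #+#ᶜ Y ⟨
    # Y + # (compl Y)       ≡⟨ cong (_+ # (compl Y)) #Y ⟩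
    2 ^ k + # (compl Y)     ∎)
    where open ≤-Reasoning
  2^k≤Xᶜ : 2 ^ k ≤ # (compl X)
  2^k≤Xᶜ = co-large X #X
  1≤h : 1 ≤ h
  1≤h = ≤-trans (m<n⇒0<n∸m (gap<2^ j p 2≤k)) h≥

⌈n/2⌉≡⌊n/2⌋+γ : ∀ n → ⌈ n /2⌉ ≡ ⌊ n /2⌋ + γ n
⌈n/2⌉≡⌊n/2⌋+γ 0 = refl
⌈n/2⌉≡⌊n/2⌋+γ 1 = refl
⌈n/2⌉≡⌊n/2⌋+γ (suc (suc n)) = cong suc (⌈n/2⌉≡⌊n/2⌋+γ n)

theorem2 : ∀ (n N : ℕ) (G : Graph N) → 4 ≤ n → H4 n N G →
    ∀ (t h : ℕ) → t < ⌊ n /2⌋ →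
    2 ^ (⌈ n /2⌉ + t) ∸ g n t ≤ h → h ≤ 2 ^ (⌈ n /2⌉ + t) →
    IsLambda h G ((⌊ n /2⌋ ∸ t) * 2 ^ (⌈ n /2⌉ + t))
    × IsXi (2 ^ (⌈ n /2⌉ + t)) G ((⌊ n /2⌋ ∸ t) * 2 ^ (⌈ n /2⌉ + t))
theorem2 n N G 4≤n H t h t<⌊n/2⌋ h≥ h≤ with m≤n⇒∃[o]m+o≡n t<⌊n/2⌋
... | j , 1+t+j≡⌊n/2⌋ =
  subst₂ (λ i k → IsLambda h G (i * 2 ^ k) × IsXi (2 ^ k) G (i * 2 ^ k)) (sym i≡) (sym k≡)
    (power-cut j p 2≤k (subst (λ m → CubeLike m G) n≡ (H4⇒CubeLike H))
      (subst₂ (λ k e → 2 ^ k ∸ e ≤ h) k≡ gap≡ h≥)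
      (subst (λ k → h ≤ 2 ^ k) k≡ h≤))
  where
  open ≡-Reasoning
  -- With j + 1 = ⌊n/2⌋ - t, this p gives k = j + 1 + p = ⌈n/2⌉ + t and n = j + 1 + k, and the
  -- exponent in `g n t` becomes p + 2.
  p = 2 * t + γ n
  i≡ : ⌊ n /2⌋ ∸ t ≡ suc j
  i≡ = trans (cong (_∸ t) (trans (sym 1+t+j≡⌊n/2⌋) (sym (+-suc t j)))) (m+n∸m≡n t (suc j))
  k≡ : ⌈ n /2⌉ + t ≡ suc j + p
  k≡ = begin
    ⌈ n /2⌉ + t              ≡⟨ cong (_+ t) (⌈n/2⌉≡⌊n/2⌋+γ n) ⟩
    ⌊ n /2⌋ + γ n + t        ≡⟨ cong (λ m → m + γ n + t) 1+t+j≡⌊n/2⌋ ⟨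
    suc t + j + γ n + t      ≡⟨ rearrange t j (γ n) ⟩
    suc j + p ∎
    where
    rearrange : ∀ t j c → suc t + j + c + t ≡ suc j + (2 * t + c)
    rearrange = solve-∀
  n≡ : n ≡ suc j + (suc j + p)
  n≡ = begin
    n                        ≡⟨ ⌊n/2⌋+⌈n/2⌉≡n n ⟨
    ⌊ n /2⌋ + ⌈ n /2⌉        ≡⟨ cong (_+ ⌈ n /2⌉) 1+t+j≡⌊n/2⌋ ⟨
    suc t + j + ⌈ n /2⌉      ≡⟨ rearrange t j ⌈ n /2⌉ ⟩
    suc j + (⌈ n /2⌉ + t)    ≡⟨ cong (suc j +_) k≡ ⟩
    suc j + (suc j + p) ∎
    where
    rearrange : ∀ t j c → suc t + j + c ≡ suc j + (c + t)
    rearrange = solve-∀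
  gap≡ : g n t ≡ gap p
  gap≡ = trans (cong (λ e → (2 ^ e + 2) / 3) (rearrange t (γ n))) (gap≡ceil p)
    where
    rearrange : ∀ t c → 2 * t + 2 + c ≡ 2 * t + c + 2
    rearrange = solve-∀
  2≤k : 2 ≤ suc j + p
  -- n ≥ 4 enters here, through ⌈n/2⌉ ≥ 2.
  2≤k = subst (2 ≤_) k≡ (≤-trans (⌈n/2⌉-mono 4≤n) (m≤m+n ⌈ n /2⌉ t))
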